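{- There exists an abelian $6$-power free morphism $h:\Sigma^*\to\Sigma^*$ over the binary alphabet $\Sigma=\{a,b\}$ with an infinite fixed point $\Omega_1\in\Sigma^{\mathbb{N}}$ such that: (i) $aaaaa$ is not a factor of $\Omega_1$; (ii) $bb$ is not a factor of $\Omega_1$; (iii) $\Omega_1$ is abelian $6$-power free.
   Context: $\Sigma^*$ is the free monoid of finite words over $\Sigma$, with empty word $\epsilon$. A morphism is a monoid homomorphism $h:\Sigma^*\to\Sigma^*$; it extends to infinite words letter by letter, and an infinite word $\Omega$ is a fixed point of $h$ if $h(\Omega)=\Omega$. A factor of a word is a contiguous finite subword. The Parikh vector $\psi(u)$ of a finite word $u$ records the number of occurrences of each letter in $u$. A word $u$ (finite or infinite) is abelian $k$-power free if whenever $u=xv_1\cdots v_ky$ with $\psi(v_1)=\cdots=\psi(v_k)$, one has $v_1=\cdots=v_k=\epsilon$. A morphism $h$ is abelian $n$-power free if $h(u)$ is abelian $n$-power free for every abelian $n$-power free word $u$. -}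

module Defs where

open import Algebra.Morphism.Structures using (module MonoidMorphisms)
open import Data.List using (List; []; _∷_; [_]; _++_; concat; filter; length; applyUpTo; ++-[]-rawMonoid)
open import Data.Nat using (ℕ; zero; suc; _≤_)
open import Data.Product using (_×_; ∃-syntax)
open import Data.Vec using (Vec; lookup; toList)
open import Relation.Binary.Definitions using (DecidableEquality)
open import Relation.Binary.PropositionalEquality using (_≡_; _≗_; refl)
open import Relation.Nullary using (yes; no)

data Letter : Set where
  a b : Letter

_≟_ : DecidableEquality Letter
a ≟ a = yes refl
a ≟ b = no λ ()
b ≟ a = no λ ()
b ≟ b = yes refl

Word : Set
Word = List Letter

-- Infinite words are functions, so they are compared with _≗_ rather than _≡_.
InfWord : Set
InfWord = ℕ → Letter

infixr 5 _++ω_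

_++ω_ : Word → InfWord → InfWord
([]      ++ω w) n       = w n
((c ∷ u) ++ω w) zero    = c
((c ∷ u) ++ω w) (suc n) = (u ++ω w) n

IsFactor : Word → InfWord → Set
IsFactor u Ω = ∃[ x ] ∃[ y ] Ω ≗ x ++ω (u ++ω y)

ψ : Word → Letter → ℕ
ψ u c = length (filter (c ≟_) u)

SameParikh : ∀ {k} → Vec Word k → Set
SameParikh vs = ∀ i j → ψ (lookup vs i) ≗ ψ (lookup vs j)

AllEmpty : ∀ {k} → Vec Word k → Set
AllEmpty vs = ∀ i → lookup vs i ≡ []

AbelianPowerFree : ℕ → Word → Set
AbelianPowerFree k u =
  ∀ (x : Word) (vs : Vec Word k) (y : Word) →
  u ≡ x ++ concat (toList vs) ++ y → SameParikh vs → AllEmpty vs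

AbelianPowerFreeω : ℕ → InfWord → Set
AbelianPowerFreeω k Ω =
  ∀ (x : Word) (vs : Vec Word k) (y : InfWord) →
  Ω ≗ x ++ω (concat (toList vs) ++ω y) → SameParikh vs → AllEmpty vs

IsMorphism : (Word → Word) → Set
IsMorphism = IsMonoidHomomorphism
  where open MonoidMorphisms (++-[]-rawMonoid Letter) (++-[]-rawMonoid Letter)

AbelianPowerFreeMorphism : ℕ → (Word → Word) → Set
AbelianPowerFreeMorphism n h =
  ∀ (u : Word) → AbelianPowerFree n u → AbelianPowerFree n (h u)

-- W is the infinite concatenation us 0 · us 1 · us 2 ⋯ : every finite partial
-- concatenation is a prefix of W, and these have unbounded length.  The second
-- conjunct is needed because some us i may be empty, in which case the
-- concatenation could be finite and not determine an infinite word.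
IsInfiniteConcat : (ℕ → Word) → InfWord → Set
IsInfiniteConcat us W =
  (∀ n → ∃[ y ] W ≗ concat (applyUpTo us n) ++ω y) ×
  (∀ m → ∃[ n ] m ≤ length (concat (applyUpTo us n)))

-- h(Ω) = W, where h(Ω) = h(Ω₀) h(Ω₁) h(Ω₂) ⋯ .  This is a relation because
-- h(Ω) is not always infinite when h erases letters.
MapsTo : (Word → Word) → InfWord → InfWord → Set
MapsTo h Ω W = IsInfiniteConcat (λ i → h [ Ω i ]) W

IsFixedPoint : (Word → Word) → InfWord → Set
IsFixedPoint h Ω = MapsTo h Ω Ω

{-# OPTIONS --safe #-}
-- Take h(a) = abaaa and h(b) = bab.  Give a word the phase |u|_a + 3|u|_b; every
-- block h(c) has phase 7, and the proper prefixes of the two blocks have phases in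
-- {0,1,3,4,5,6}, their phase determining their Parikh vector.  The seven cut
-- points of an abelian 6-th power in h(u) have phases in arithmetic progression
-- modulo 7.  As no cut point has phase 2, the common difference is 0 mod 7, so all
-- cut points leave the same Parikh vector inside their blocks.  Hence the power
-- has the Parikh vectors of an abelian 6-th power h(w₁)⋯h(w₆) with w₁⋯w₆ a factor
-- of u, and since the incidence matrix of h has determinant 7, w₁⋯w₆ is an abelian
-- power.  The fixed point is the limit of hⁿ(a).
module Submission where

open import Defs
open import Data.Empty using (⊥-elim)
open import Data.Fin as Fin using (Fin; zero; suc; toℕ; fromℕ<)
open import Data.Fin.Properties using (all?; any?; toℕ-fromℕ<)
open import Data.List using ([]; _∷_; [_]; _++_; concat; concatMap; take; drop; length; filter; applyUpTo)
open import Data.List.Properties using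
  (concatMap-++; filter-++; length-++; ++-assoc; ++-identityʳ; ++-conicalˡ; ++-conicalʳ; length-applyUpTo)
open import Data.Nat using (ℕ; zero; suc; _+_; _*_; _≤_; _<_; z≤n; s≤s; z<s; s<s; _%_)
import Data.Nat as ℕ
open import Data.Nat.DivMod using (_/_; m%n<n; m≡m%n+[m/n]*n; %-distribˡ-+; [m+kn]%n≡m%n)
open import Data.Nat.Properties hiding (_≟_)
open import Data.Nat.Tactic.RingSolver using (solve-∀)
open import Data.Product using (_×_; _,_; proj₁; proj₂; ∃-syntax)
open import Data.Sum using (_⊎_; inj₁; inj₂)
open import Data.Vec using (Vec; []; _∷_; lookup; toList)
open import Data.Vec.Relation.Binary.Pointwise.Inductive as Pointwise using (Pointwise; []; _∷_)
open import Relation.Binary.PropositionalEquality hiding ([_])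
open import Relation.Nullary using (¬_)
open import Relation.Nullary.Decidable using (from-yes; _⊎-dec_)

-- The morphism

block : Letter → Word
block a = a ∷ b ∷ a ∷ a ∷ a ∷ []
block b = b ∷ a ∷ b ∷ []

h : Word → Word
h = concatMap block

h-++ : ∀ u v → h (u ++ v) ≡ h u ++ h v
h-++ = concatMap-++ block

h-isMorphism : IsMorphism h
h-isMorphism = record
  { isMagmaHomomorphism = record
    { isRelHomomorphism = record { cong = cong h }
    ; homo = h-++
    }
  ; ε-homo = refl
  }

-- Parikh vectors

ψ-++ : ∀ u v c → ψ (u ++ v) c ≡ ψ u c + ψ v c
ψ-++ u v c = trans (cong length (filter-++ (c ≟_) u v)) (length-++ (filter (c ≟_) u))

ψ≗0⇒≡[] : ∀ u → ψ u ≗ ψ [] → u ≡ []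
ψ≗0⇒≡[] []      eq = refl
ψ≗0⇒≡[] (a ∷ u) eq with () ← eq a
ψ≗0⇒≡[] (b ∷ u) eq with () ← eq b

ψ-h : ∀ u → ψ (h u) a ≡ 4 * ψ u a + ψ u b × ψ (h u) b ≡ ψ u a + 2 * ψ u b
ψ-h []      = refl , refl
ψ-h (a ∷ u) with ea , eb ← ψ-h u =
  trans (cong (4 +_) ea) (lemma (ψ u a) (ψ u b)) , cong suc eb
  where
  lemma : ∀ m n → 4 + (4 * m + n) ≡ 4 * suc m + n
  lemma = solve-∀
ψ-h (b ∷ u) with ea , eb ← ψ-h u =
  trans (cong suc ea) (sym (+-suc _ _)) , trans (cong (2 +_) eb) (lemma (ψ u a) (ψ u b))
  where
  lemma : ∀ m n → 2 + (m + 2 * n) ≡ m + 2 * suc n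
  lemma = solve-∀

-- Twice the first equation minus the second isolates `7 * m`, where 7 is the determinant of the
-- incidence matrix.
matrix-injective : ∀ m n m′ n′ → 4 * m + n ≡ 4 * m′ + n′ → m + 2 * n ≡ m′ + 2 * n′ →
                   m ≡ m′ × n ≡ n′
matrix-injective m n m′ n′ p q = m≡m′ , n≡n′
  where
  open ≡-Reasoning
  lemma : ∀ m n → 2 * (4 * m + n) ≡ 7 * m + (m + 2 * n)
  lemma = solve-∀
  m≡m′ : m ≡ m′
  m≡m′ = *-cancelˡ-≡ m m′ 7 (+-cancelʳ-≡ (m′ + 2 * n′) (7 * m) (7 * m′) (begin
    7 * m + (m′ + 2 * n′)   ≡⟨ cong (7 * m +_) q ⟨
    7 * m + (m + 2 * n)     ≡⟨ lemma m n ⟨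
    2 * (4 * m + n)         ≡⟨ cong (2 *_) p ⟩
    2 * (4 * m′ + n′)       ≡⟨ lemma m′ n′ ⟩
    7 * m′ + (m′ + 2 * n′)  ∎))
  n≡n′ : n ≡ n′
  n≡n′ = +-cancelˡ-≡ (4 * m) n n′ (trans p (cong (λ k → 4 * k + n′) (sym m≡m′)))

ψ-h-injective : ∀ u v → ψ (h u) ≗ ψ (h v) → ψ u ≗ ψ v
ψ-h-injective u v eq = λ { a → proj₁ both ; b → proj₂ both }
  where
  both = matrix-injective (ψ u a) (ψ u b) (ψ v a) (ψ v b)
    (trans (sym (proj₁ (ψ-h u))) (trans (eq a) (proj₁ (ψ-h v))))
    (trans (sym (proj₂ (ψ-h u))) (trans (eq b) (proj₂ (ψ-h v))))

-- Phases

-- The weights 1 and 3 span the left kernel modulo 7 of the incidence matrix of `h`, so images have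
-- phase divisible by 7.
phase : Word → ℕ
phase u = ψ u a + 3 * ψ u b

phase-cong : ∀ u v → ψ u ≗ ψ v → phase u ≡ phase v
phase-cong u v eq = cong₂ (λ m n → m + 3 * n) (eq a) (eq b)

phase-++ : ∀ u v → phase (u ++ v) ≡ phase u + phase v
phase-++ u v = trans (cong₂ (λ m n → m + 3 * n) (ψ-++ u v a) (ψ-++ u v b))
                     (lemma (ψ u a) (ψ v a) (ψ u b) (ψ v b))
  where
  lemma : ∀ m m′ n n′ → (m + m′) + 3 * (n + n′) ≡ (m + 3 * n) + (m′ + 3 * n′)
  lemma = solve-∀

phase-h : ∀ u → phase (h u) ≡ (ψ u a + ψ u b) * 7
phase-h u = trans (cong₂ (λ m n → m + 3 * n) (proj₁ (ψ-h u)) (proj₂ (ψ-h u)))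
                  (lemma (ψ u a) (ψ u b))
  where
  lemma : ∀ m n → (4 * m + n) + 3 * (m + 2 * n) ≡ (m + n) * 7
  lemma = solve-∀

data ProperPrefix : Word → Set where
  ε     : ProperPrefix []
  a·    : ProperPrefix (a ∷ [])
  ab·   : ProperPrefix (a ∷ b ∷ [])
  aba·  : ProperPrefix (a ∷ b ∷ a ∷ [])
  abaa· : ProperPrefix (a ∷ b ∷ a ∷ a ∷ [])
  b·    : ProperPrefix (b ∷ [])
  ba·   : ProperPrefix (b ∷ a ∷ [])

phase%7≢2 : ∀ {r} → ProperPrefix r → phase r % 7 ≢ 2
phase%7≢2 ε     ()
phase%7≢2 a·    ()
phase%7≢2 ab·   ()
phase%7≢2 aba·  ()
phase%7≢2 abaa· ()
phase%7≢2 b·    ()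
phase%7≢2 ba·   ()

-- Residue 4 belongs to both `ab` and `ba`. The default covers 0, the empty prefix, and 2, which
-- never occurs.
parikhOfPhase : ℕ → Letter → ℕ
parikhOfPhase 1 = ψ (a ∷ [])
parikhOfPhase 3 = ψ (b ∷ [])
parikhOfPhase 4 = ψ (a ∷ b ∷ [])
parikhOfPhase 5 = ψ (a ∷ b ∷ a ∷ [])
parikhOfPhase 6 = ψ (a ∷ b ∷ a ∷ a ∷ [])
parikhOfPhase _ = ψ []

ψ≗parikhOfPhase : ∀ {r} → ProperPrefix r → ψ r ≗ parikhOfPhase (phase r % 7)
ψ≗parikhOfPhase ε     _ = refl
ψ≗parikhOfPhase a·    _ = refl
ψ≗parikhOfPhase ab·   _ = refl
ψ≗parikhOfPhase aba·  _ = refl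
ψ≗parikhOfPhase abaa· _ = refl
ψ≗parikhOfPhase b·    _ = refl
-- `ba` is compared with the stored `ab`, and the two counts compute to the same number only once
-- the letter is known.
ψ≗parikhOfPhase ba·   a = refl
ψ≗parikhOfPhase ba·   b = refl

phase-determines-ψ : ∀ {r s} → ProperPrefix r → ProperPrefix s →
                     phase r % 7 ≡ phase s % 7 → ψ r ≗ ψ s
phase-determines-ψ pr ps eq c =
  trans (ψ≗parikhOfPhase pr c) (trans (cong (λ n → parikhOfPhase n c) eq) (sym (ψ≗parikhOfPhase ps c)))

-- Desubstitution

-- A block cut in two stays whole in `u₂`; `r` is its part before the cut, whence `h u₂ ≡ r ++ q`.
split : ∀ u p {q} → h u ≡ p ++ q →
        ∃[ u₁ ] ∃[ u₂ ] ∃[ r ] (ProperPrefix r × u ≡ u₁ ++ u₂ × p ≡ h u₁ ++ r × h u₂ ≡ r ++ q)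
split u [] eq = [] , u , [] , ε , refl , refl , eq
split [] (x ∷ p) ()
split u@(a ∷ _) (_ ∷ []) refl = [] , u , _ , a· , refl , refl , refl
split u@(a ∷ _) (_ ∷ _ ∷ []) refl = [] , u , _ , ab· , refl , refl , refl
split u@(a ∷ _) (_ ∷ _ ∷ _ ∷ []) refl = [] , u , _ , aba· , refl , refl , refl
split u@(a ∷ _) (_ ∷ _ ∷ _ ∷ _ ∷ []) refl = [] , u , _ , abaa· , refl , refl , refl
split (a ∷ u) (_ ∷ _ ∷ _ ∷ _ ∷ _ ∷ p) eq
  with refl ← cong (take 5) eq
  with u₁ , u₂ , r , pr , e₁ , e₂ , e₃ ← split u p (cong (drop 5) eq)
  = a ∷ u₁ , u₂ , r , pr , cong (a ∷_) e₁ , cong (block a ++_) e₂ , e₃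
split u@(b ∷ _) (_ ∷ []) refl = [] , u , _ , b· , refl , refl , refl
split u@(b ∷ _) (_ ∷ _ ∷ []) refl = [] , u , _ , ba· , refl , refl , refl
split (b ∷ u) (_ ∷ _ ∷ _ ∷ p) eq
  with refl ← cong (take 3) eq
  with u₁ , u₂ , r , pr , e₁ , e₂ , e₃ ← split u p (cong (drop 3) eq)
  = b ∷ u₁ , u₂ , r , pr , cong (b ∷_) e₁ , cong (block b ++_) e₂ , e₃

-- `r` and `s` are the parts of blocks left over at the cuts before and after `v`; `w` collects the
-- letters whose blocks end inside `v`. Since `s` also starts the tail, `k` factors have `k + 1` cut
-- points.
data Desubstitution : Word → ∀ {k} → Vec Word k → Vec Word k → Set where
  done : ∀ {r} → ProperPrefix r → Desubstitution r [] []
  step : ∀ {r s v w k} {vs ws : Vec Word k} → ProperPrefix r → ProperPrefix s →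
         r ++ v ≡ h w ++ s → Desubstitution s vs ws → Desubstitution r (v ∷ vs) (w ∷ ws)

desubstitute : ∀ {k} (vs : Vec Word k) {r u y} → ProperPrefix r → h u ≡ r ++ concat (toList vs) ++ y →
               ∃[ ws ] ∃[ z ] (u ≡ concat (toList ws) ++ z × Desubstitution r vs ws)
desubstitute []       {u = u} pr eq = [] , u , refl , done pr
desubstitute (v ∷ vs) {r} {u} {y} pr eq
  with w , u₂ , s , ps , refl , e₂ , e₃ ←
    split u (r ++ v) (trans eq (trans (cong (r ++_) (++-assoc v _ y)) (sym (++-assoc r v _))))
  with ws , z , refl , d ← desubstitute vs {u = u₂} ps e₃
  = w ∷ ws , z , sym (++-assoc w _ z) , step pr ps e₂ d

-- Modulo 7 the image `h w` contributes nothing, so passing `v` moves the phase of the cut by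
-- `phase v`.
phase-step : ∀ {r v w s} → r ++ v ≡ h w ++ s → (phase r + phase v) % 7 ≡ phase s % 7
phase-step {r} {v} {w} {s} eq = begin
  (phase r + phase v) % 7                ≡⟨ cong (_% 7) (phase-++ r v) ⟨
  phase (r ++ v) % 7                     ≡⟨ cong (λ u → phase u % 7) eq ⟩
  phase (h w ++ s) % 7                   ≡⟨ cong (_% 7) (phase-++ (h w) s) ⟩
  (phase (h w) + phase s) % 7            ≡⟨ cong (_% 7) (+-comm (phase (h w)) _) ⟩
  (phase s + phase (h w)) % 7            ≡⟨ cong (λ n → (phase s + n) % 7) (phase-h w) ⟩
  (phase s + (ψ w a + ψ w b) * 7) % 7    ≡⟨ [m+kn]%n≡m%n (phase s) (ψ w a + ψ w b) 7 ⟩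
  phase s % 7                            ∎
  where open ≡-Reasoning

-- Arithmetic progressions modulo 7

%-congˡ-+ : ∀ {m n} k → m % 7 ≡ n % 7 → (m + k) % 7 ≡ (n + k) % 7
%-congˡ-+ {m} {n} k eq =
  trans (%-distribˡ-+ m k 7) (trans (cong (λ l → (l + k % 7) % 7) eq) (sym (%-distribˡ-+ n k 7)))

-- Term `i` is congruent to the phase of the leftover at cut point `i`, which is a proper prefix of
-- a block.
progression-avoids-2 : ∀ {k r d} {vs ws : Vec Word k} → Desubstitution r vs ws →
                       (∀ i → phase (lookup vs i) ≡ d) →
                       ∀ (i : Fin (suc k)) → (phase r + toℕ i * d) % 7 ≢ 2
progression-avoids-2 {r = r} (done pr) _ zero eq = phase%7≢2 pr (trans (cong (_% 7) (sym (+-identityʳ (phase r)))) eq)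
progression-avoids-2 {r = r} (step pr _ _ _) _ zero eq = phase%7≢2 pr (trans (cong (_% 7) (sym (+-identityʳ (phase r)))) eq)
progression-avoids-2 {r = r} {d} (step {s = s} {v} {w} pr ps e ds) vs≡d (suc i) eq =
  progression-avoids-2 ds (λ j → vs≡d (suc j)) i (begin
    (phase s + toℕ i * d) % 7              ≡⟨ %-congˡ-+ {phase s} {phase r + phase v} (toℕ i * d) (sym (phase-step {r} {v} {w} e)) ⟩
    (phase r + phase v + toℕ i * d) % 7    ≡⟨ cong (λ n → (phase r + n + toℕ i * d) % 7) (vs≡d zero) ⟩
    (phase r + d + toℕ i * d) % 7          ≡⟨ cong (_% 7) (+-assoc (phase r) d _) ⟩
    (phase r + (d + toℕ i * d)) % 7        ≡⟨ eq ⟩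
    2                                      ∎)
  where open ≡-Reasoning

-- As 7 is prime, seven terms with nonzero difference meet every residue; the 49 pairs are checked
-- by evaluation. A sixth power has exactly seven cut points.
progression-hits-2 : ∀ (e d : Fin 7) → d ≡ zero ⊎ ∃[ i ] (toℕ e + toℕ {7} i * toℕ d) % 7 ≡ 2
progression-hits-2 = from-yes (all? {7} λ e → all? {7} λ d →
  (d Fin.≟ zero) ⊎-dec any? {7} λ i → (toℕ e + toℕ i * toℕ d) % 7 ℕ.≟ 2)

avoids-2⇒constant : ∀ e d → (∀ (i : Fin 7) → (e + toℕ i * d) % 7 ≢ 2) → d % 7 ≡ 0
avoids-2⇒constant e d avoids
  with progression-hits-2 (fromℕ< (m%n<n e 7)) (fromℕ< (m%n<n d 7))
... | inj₁ eq = trans (sym (toℕ-fromℕ< (m%n<n d 7))) (cong toℕ eq)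
... | inj₂ (i , eq) = ⊥-elim (avoids i (begin
    (e + toℕ i * d) % 7                      ≡⟨ reduce ⟩
    (e % 7 + toℕ i * (d % 7)) % 7            ≡⟨ cong₂ (λ m n → (m + toℕ i * n) % 7) (toℕ-fromℕ< e<7) (toℕ-fromℕ< d<7) ⟨
    (toℕ e′ + toℕ i * toℕ d′) % 7            ≡⟨ eq ⟩
    2                                        ∎))
  where
  open ≡-Reasoning
  e<7 = m%n<n e 7
  d<7 = m%n<n d 7
  e′ = fromℕ< e<7
  d′ = fromℕ< d<7
  regroup : ∀ m n k p q → (m + p * 7) + k * (n + q * 7) ≡ (m + k * n) + (p + k * q) * 7
  regroup = solve-∀
  reduce : (e + toℕ i * d) % 7 ≡ (e % 7 + toℕ i * (d % 7)) % 7
  reduce = begin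
    (e + toℕ i * d) % 7
      ≡⟨ cong₂ (λ m n → (m + toℕ i * n) % 7) (m≡m%n+[m/n]*n e 7) (m≡m%n+[m/n]*n d 7) ⟩
    ((e % 7 + e / 7 * 7) + toℕ i * (d % 7 + d / 7 * 7)) % 7
      ≡⟨ cong (_% 7) (regroup (e % 7) (d % 7) (toℕ i) (e / 7) (d / 7)) ⟩
    ((e % 7 + toℕ i * (d % 7)) + (e / 7 + toℕ i * (d / 7)) * 7) % 7
      ≡⟨ [m+kn]%n≡m%n (e % 7 + toℕ i * (d % 7)) (e / 7 + toℕ i * (d / 7)) 7 ⟩
    (e % 7 + toℕ i * (d % 7)) % 7 ∎

-- Equal residues give `r` and `s` equal Parikh vectors, which cancel from `r ++ v ≡ h w ++ s`.
aligned : ∀ {k r} {vs ws : Vec Word k} → Desubstitution r vs ws →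
          (∀ i → phase (lookup vs i) % 7 ≡ 0) →
          Pointwise (λ v w → ψ v ≗ ψ (h w)) vs ws
aligned (done _) _ = []
aligned {r = r} (step {s = s} {v} {w} pr ps e ds) vs≡0 = ψv≗ψhw ∷ aligned ds (λ i → vs≡0 (suc i))
  where
  open ≡-Reasoning
  same-phase : phase r % 7 ≡ phase s % 7
  same-phase = begin
    (0 + phase r) % 7                    ≡⟨ %-congˡ-+ {0} {phase v} (phase r) (sym (vs≡0 zero)) ⟩
    (phase v + phase r) % 7              ≡⟨ cong (_% 7) (+-comm (phase v) _) ⟩
    (phase r + phase v) % 7              ≡⟨ phase-step {r} {v} {w} e ⟩
    phase s % 7                          ∎
  ψv≗ψhw : ψ v ≗ ψ (h w)
  ψv≗ψhw c = +-cancelˡ-≡ (ψ r c) (ψ v c) (ψ (h w) c) (begin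
    ψ r c + ψ v c      ≡⟨ ψ-++ r v c ⟨
    ψ (r ++ v) c       ≡⟨ cong (λ u → ψ u c) e ⟩
    ψ (h w ++ s) c     ≡⟨ ψ-++ (h w) s c ⟩
    ψ (h w) c + ψ s c  ≡⟨ +-comm (ψ (h w) c) _ ⟩
    ψ s c + ψ (h w) c  ≡⟨ cong (_+ ψ (h w) c) (phase-determines-ψ pr ps same-phase c) ⟨
    ψ r c + ψ (h w) c  ∎)

-- Power-freeness of the morphism

h-powerFree : AbelianPowerFreeMorphism 6 h
h-powerFree u free x vs y eq same
  with u₁ , u₂ , r , pr , refl , _ , e₂ ← split u x eq
  with ws , z , refl , ds ← desubstitute vs {u = u₂} pr e₂
  -- Power-freeness of `u` empties every word of `ws`, so each word of `vs` has the Parikh vector of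
  -- `h []`.
  = λ i → ψ≗0⇒≡[] (lookup vs i) λ c →
      trans (Pointwise.lookup vs≈ws i c) (cong (λ w → ψ (h w) c) (free u₁ ws z refl same′ i))
  where
  d≡0 : phase (lookup vs zero) % 7 ≡ 0
  d≡0 = avoids-2⇒constant (phase r) _
    (progression-avoids-2 ds (λ i → phase-cong (lookup vs i) (lookup vs zero) (same i zero)))
  vs≈ws : Pointwise (λ v w → ψ v ≗ ψ (h w)) vs ws
  vs≈ws = aligned ds (λ i → trans (cong (_% 7) (phase-cong (lookup vs i) (lookup vs zero) (same i zero))) d≡0)
  same′ : SameParikh ws
  same′ i j = ψ-h-injective (lookup ws i) (lookup ws j) λ c →
    trans (sym (Pointwise.lookup vs≈ws i c)) (trans (same i j c) (Pointwise.lookup vs≈ws j c))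

-- The fixed point

h^_[a] : ℕ → Word
h^ zero  [a] = [ a ]
h^ suc n [a] = h (h^ n [a])

-- The padding is never read, because hⁿ(a) has more than n letters.
Ω : InfWord
Ω n = (h^ n [a] ++ω λ _ → a) n

-- A nonempty first factor would use up the only letter and leave the second empty, against equal
-- Parikh vectors; the other factors share the Parikh vector of the first.
[a]-powerFree : AbelianPowerFree 6 [ a ]
[a]-powerFree x vs@(v ∷ v′ ∷ vs′) y eq same i =
  ψ≗0⇒≡[] (lookup vs i) λ c → trans (same i zero c) (cong (λ w → ψ w c) (v≡[] x v eq (same zero (suc zero))))
  where
  v≡[] : ∀ x v → [ a ] ≡ x ++ (v ++ v′ ++ concat (toList vs′)) ++ y → ψ v ≗ ψ v′ → v ≡ []
  v≡[] x           []        _  _  = refl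
  v≡[] []          v@(_ ∷ u) eq v≗v′ = ψ≗0⇒≡[] v λ c → trans (v≗v′ c) (cong (λ w → ψ w c)
    (++-conicalˡ v′ _ (++-conicalʳ u _ (++-conicalˡ _ y (sym (cong (drop 1) eq))))))
  v≡[] (_ ∷ [])    (_ ∷ _)   () _
  v≡[] (_ ∷ _ ∷ _) (_ ∷ _)   () _

h^-powerFree : ∀ n → AbelianPowerFree 6 h^ n [a]
h^-powerFree zero    = [a]-powerFree
h^-powerFree (suc n) = h-powerFree h^ n [a] (h^-powerFree n)

-- `bb` occurs inside no block, and across a boundary only between two copies of `block b`, which
-- requires `bb` in `u`.
¬bb-h : ∀ u → (∀ x y → u ≢ x ++ b ∷ b ∷ y) → ∀ x y → h u ≢ x ++ b ∷ b ∷ y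
¬bb-h []      free []      y ()
¬bb-h []      free (_ ∷ _) y ()
¬bb-h (a ∷ u) free [] y ()
¬bb-h (a ∷ u) free (_ ∷ []) y ()
¬bb-h (a ∷ u) free (_ ∷ _ ∷ []) y ()
¬bb-h (a ∷ u) free (_ ∷ _ ∷ _ ∷ []) y ()
¬bb-h (a ∷ u) free (_ ∷ _ ∷ _ ∷ _ ∷ []) y ()
¬bb-h (a ∷ u) free (_ ∷ _ ∷ _ ∷ _ ∷ _ ∷ x) y eq =
  ¬bb-h u (λ x y e → free (a ∷ x) y (cong (a ∷_) e)) x y (cong (drop 5) eq)
¬bb-h (b ∷ u) free [] y ()
¬bb-h (b ∷ u) free (_ ∷ []) y ()
¬bb-h (b ∷ []) free (_ ∷ _ ∷ []) y ()
¬bb-h (b ∷ a ∷ u) free (_ ∷ _ ∷ []) y ()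
¬bb-h (b ∷ b ∷ u) free (_ ∷ _ ∷ []) y eq = free [] u refl
¬bb-h (b ∷ u) free (_ ∷ _ ∷ _ ∷ x) y eq =
  ¬bb-h u (λ x y e → free (b ∷ x) y (cong (b ∷_) e)) x y (cong (drop 3) eq)

-- The longest possible run has four letters: the final `aaa` of `block a` and the single `a`
-- opening another `block a`.
¬aaaaa-h : ∀ u x y → h u ≢ x ++ a ∷ a ∷ a ∷ a ∷ a ∷ y
¬aaaaa-h []      []      y ()
¬aaaaa-h []      (_ ∷ _) y ()
¬aaaaa-h (a ∷ u) [] y ()
¬aaaaa-h (a ∷ u) (_ ∷ []) y ()
¬aaaaa-h (a ∷ []) (_ ∷ _ ∷ []) y ()
¬aaaaa-h (a ∷ a ∷ u) (_ ∷ _ ∷ []) y ()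
¬aaaaa-h (a ∷ b ∷ u) (_ ∷ _ ∷ []) y ()
¬aaaaa-h (a ∷ []) (_ ∷ _ ∷ _ ∷ []) y ()
¬aaaaa-h (a ∷ a ∷ u) (_ ∷ _ ∷ _ ∷ []) y ()
¬aaaaa-h (a ∷ b ∷ u) (_ ∷ _ ∷ _ ∷ []) y ()
¬aaaaa-h (a ∷ []) (_ ∷ _ ∷ _ ∷ _ ∷ []) y ()
¬aaaaa-h (a ∷ a ∷ u) (_ ∷ _ ∷ _ ∷ _ ∷ []) y ()
¬aaaaa-h (a ∷ b ∷ u) (_ ∷ _ ∷ _ ∷ _ ∷ []) y ()
¬aaaaa-h (a ∷ u) (_ ∷ _ ∷ _ ∷ _ ∷ _ ∷ x) y eq = ¬aaaaa-h u x y (cong (drop 5) eq)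
¬aaaaa-h (b ∷ u) [] y ()
¬aaaaa-h (b ∷ u) (_ ∷ []) y ()
¬aaaaa-h (b ∷ u) (_ ∷ _ ∷ []) y ()
¬aaaaa-h (b ∷ u) (_ ∷ _ ∷ _ ∷ x) y eq = ¬aaaaa-h u x y (cong (drop 3) eq)

h^-noBB : ∀ n x y → h^ n [a] ≢ x ++ b ∷ b ∷ y
h^-noBB zero    []          y ()
h^-noBB zero    (_ ∷ [])    y ()
h^-noBB zero    (_ ∷ _ ∷ _) y ()
h^-noBB (suc n) = ¬bb-h h^ n [a] (h^-noBB n)

-- Convergence of the iterates

length-h : ∀ u → length u ≤ length (h u)
length-h []      = z≤n
length-h (a ∷ u) = s≤s (≤-trans (length-h u) (m≤n+m _ 4))
length-h (b ∷ u) = s≤s (≤-trans (length-h u) (m≤n+m _ 2))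

-- `h [ a ]` starts with `a`, and applying `h` preserves the prefix relation.
h^-prefix-suc : ∀ n → ∃[ z ] h^ suc n [a] ≡ h^ n [a] ++ z
h^-prefix-suc zero = _ , refl
h^-prefix-suc (suc n) with z , eq ← h^-prefix-suc n =
  h z , trans (cong h eq) (h-++ h^ n [a] z)

h^-prefix : ∀ {m n} → m ℕ.≤′ n → ∃[ z ] h^ n [a] ≡ h^ m [a] ++ z
h^-prefix ℕ.≤′-refl = [] , sym (++-identityʳ _)
h^-prefix {m} (ℕ.≤′-step {n} m≤n)
  with z , eq ← h^-prefix m≤n | z′ , eq′ ← h^-prefix-suc n
  = z ++ z′ , trans eq′ (trans (cong (_++ z′) eq) (++-assoc h^ m [a] z z′))

h^-head : ∀ n → ∃[ u ] h^ n [a] ≡ a ∷ u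
h^-head zero = [] , refl
h^-head (suc n) with u , eq ← h^-head n = _ , cong h eq

-- The leading `a` grows to five letters and the rest does not shrink. Strictness puts position `n`
-- inside `h^ n [a]`.
h^-length : ∀ n → n < length h^ n [a]
h^-length zero = z<s
h^-length (suc n) with h^ n [a] | h^-head n | h^-length n
... | _ | u , refl | s≤s n≤u = s≤s (s≤s (≤-trans n≤u (≤-trans (length-h u) (m≤n+m _ 3))))

++ω-prefix-agree : ∀ u z {y y′} i → i < length u → ((u ++ z) ++ω y) i ≡ (u ++ω y′) i
++ω-prefix-agree (_ ∷ u) z zero    _         = refl
++ω-prefix-agree (_ ∷ u) z (suc i) (s≤s i<u) = ++ω-prefix-agree u z i i<u

++ω-assoc : ∀ u v y → (u ++ v) ++ω y ≗ u ++ω (v ++ω y)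
++ω-assoc []      v y i       = refl
++ω-assoc (_ ∷ u) v y zero    = refl
++ω-assoc (_ ∷ u) v y (suc i) = ++ω-assoc u v y i

++ω-fromAgree : ∀ u {y} (W : InfWord) → (∀ i → i < length u → W i ≡ (u ++ω y) i) →
                W ≗ u ++ω λ i → W (length u + i)
++ω-fromAgree []      W eq i       = refl
++ω-fromAgree (_ ∷ u) W eq zero    = eq 0 z<s
++ω-fromAgree (_ ∷ u) W eq (suc i) = ++ω-fromAgree u (λ j → W (suc j)) (λ j j<u → eq (suc j) (s<s j<u)) i

++ω-prefix : ∀ u w {y y′} → u ++ω y ≗ w ++ω y′ → length w ≤ length u → ∃[ z ] u ≡ w ++ z
++ω-prefix u       []      eq _ = u , refl
++ω-prefix (c ∷ u) (d ∷ w) eq (s≤s w≤u)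
  with refl ← eq 0 | z , refl ← ++ω-prefix u w (λ i → eq (suc i)) w≤u = z , refl

-- `Ω i` is read from `h^ i [a]`, and one of `h^ i [a]` and `h^ n [a]` is a prefix of the other.
Ω-prefix : ∀ n → ∃[ y ] Ω ≗ h^ n [a] ++ω y
Ω-prefix n = _ , ++ω-fromAgree h^ n [a] Ω agree
  where
  agree : ∀ i → i < length h^ n [a] → Ω i ≡ (h^ n [a] ++ω λ _ → a) i
  agree i i<n with ≤-total i n
  ... | inj₁ i≤n with z , eq ← h^-prefix (≤⇒≤′ i≤n) =
    sym (trans (cong (λ u → (u ++ω _) i) eq) (++ω-prefix-agree h^ i [a] z i (h^-length i)))
  ... | inj₂ n≤i with z , eq ← h^-prefix (≤⇒≤′ n≤i) =
    trans (cong (λ u → (u ++ω _) i) eq) (++ω-prefix-agree h^ n [a] z i i<n)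

prefix⇒h^-prefix : ∀ w {y} → Ω ≗ w ++ω y → ∃[ z ] h^ length w [a] ≡ w ++ z
prefix⇒h^-prefix w eq with y′ , eq′ ← Ω-prefix (length w) =
  ++ω-prefix h^ length w [a] w (λ i → trans (sym (eq′ i)) (eq i)) (<⇒≤ (h^-length (length w)))

-- Transfers questions about factors of `Ω` to the finite iterates.
factor⇒h^-factor : ∀ x u {y} → Ω ≗ x ++ω (u ++ω y) → ∃[ n ] ∃[ z ] h^ n [a] ≡ x ++ u ++ z
factor⇒h^-factor x u eq
  with z , eq′ ← prefix⇒h^-prefix (x ++ u) (λ i → trans (eq i) (sym (++ω-assoc x u _ i)))
  = length (x ++ u) , z , trans eq′ (++-assoc x u z)

-- Invariance under the morphism

applyUpTo-prefix : ∀ (W : InfWord) n → W ≗ applyUpTo W n ++ω λ i → W (n + i)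
applyUpTo-prefix W zero    i       = refl
applyUpTo-prefix W (suc n) zero    = refl
applyUpTo-prefix W (suc n) (suc i) = applyUpTo-prefix (λ j → W (suc j)) n i

concat-images : ∀ (W : InfWord) n → concat (applyUpTo (λ i → h [ W i ]) n) ≡ h (applyUpTo W n)
concat-images W zero    = refl
concat-images W (suc n) = cong₂ _++_ (++-identityʳ (block (W 0))) (concat-images (λ i → W (suc i)) n)

Ω-isFixedPoint : IsFixedPoint h Ω
Ω-isFixedPoint = prefixes , λ n → n , subst₂ _≤_ (length-applyUpTo Ω n)
    (cong length (sym (concat-images Ω n))) (length-h (applyUpTo Ω n))
  where
  prefixes : ∀ n → ∃[ y ] Ω ≗ concat (applyUpTo (λ i → h [ Ω i ]) n) ++ω y
  prefixes n
    -- The prefix of length `n` begins an iterate, so its image begins the next iterate, itself a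
    -- prefix of `Ω`.
    with z , eq ← prefix⇒h^-prefix (applyUpTo Ω n) (applyUpTo-prefix Ω n)
    with y , Ω≗ ← Ω-prefix (suc (length (applyUpTo Ω n)))
    = h z ++ω y , λ i → trans (Ω≗ i) (trans
        (cong (λ u → (u ++ω y) i) (trans (cong h eq) (trans (h-++ (applyUpTo Ω n) z)
          (cong (_++ h z) (sym (concat-images Ω n))))))
        (++ω-assoc (concat (applyUpTo (λ i → h [ Ω i ]) n)) (h z) y i))

-- Factors of the fixed point

Ω-noBB : ¬ IsFactor (b ∷ b ∷ []) Ω
Ω-noBB (x , y , eq) with n , z , eq′ ← factor⇒h^-factor x (b ∷ b ∷ []) eq = h^-noBB n x z eq′

Ω-noA⁵ : ¬ IsFactor (a ∷ a ∷ a ∷ a ∷ a ∷ []) Ω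
Ω-noA⁵ (x , y , eq) with factor⇒h^-factor x (a ∷ a ∷ a ∷ a ∷ a ∷ []) eq
... | suc n , z , eq′ = ¬aaaaa-h h^ n [a] x z eq′
-- The starting word `[ a ]` is not an image under `h`; it is too short for the factor.
... | zero  , z , eq′ with x
...   | _ ∷ []    with () ← eq′
...   | _ ∷ _ ∷ _ with () ← eq′

Ω-powerFree : AbelianPowerFreeω 6 Ω
Ω-powerFree x vs y eq with n , z , eq′ ← factor⇒h^-factor x (concat (toList vs)) eq =
  h^-powerFree n x vs z eq′

theorem2p15 : ∃[ h ] (IsMorphism h × AbelianPowerFreeMorphism 6 h ×
    (∃[ Ω₁ ] (IsFixedPoint h Ω₁ ×
    ¬ IsFactor (a ∷ a ∷ a ∷ a ∷ a ∷ []) Ω₁ ×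
    ¬ IsFactor (b ∷ b ∷ []) Ω₁ ×
    AbelianPowerFreeω 6 Ω₁)))
theorem2p15 = h , h-isMorphism , h-powerFree , Ω , Ω-isFixedPoint , Ω-noA⁵ , Ω-noBB , Ω-powerFree
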